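{- Let $m$ be a positive integer and $\phi = \frac{1+\sqrt5}{2}$. The number of P-positions of $m$-Modular Wythoff's Game is finite; in particular, it is equal to $2\lfloor m/\phi \rfloor + 1$.
   Context: $m$-Modular Wythoff's Game ($m$ a positive integer): a position is an ordered pair $(p_1,p_2)$ of nonnegative integers, the numbers of tokens in two piles. Two players alternate moves. The allowed moves are: (Type I) take any positive number of tokens from exactly one pile; (Type II) take a positive number $k_1$ of tokens from the first pile and a positive number $k_2$ of tokens from the second pile, provided $k_1 \equiv k_2 \pmod m$. (Pile sizes must remain nonnegative.) The player who cannot move, i.e. whose turn it is at $(0,0)$, loses. A P-position is a position from which the previous player (the one who just moved) has a winning strategy; an N-position is one from which the next player to move has a winning strategy. Equivalently, since the game always terminates: a position is a P-position if and only if every move from it leads to an N-position, and a position is an N-position if and only if some move from it leads to a P-position. Positions are ordered pairs, so $(p_1,p_2)$ and $(p_2,p_1)$ are counted separately when $p_1\neq p_2$. -}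

module Defs where

open import Data.Nat.Base as ℕ using (ℕ)
open import Data.Nat.DivMod using (_%_)
open import Data.Integer.Base as ℤ using (ℤ; +_)
open import Data.Rational.Base
open import Data.Rational.Properties
open import Data.Rational.Solver using (module +-*-Solver)
open import Data.Product.Base using (∃; _×_; _,_; proj₁; proj₂)
open import Data.Sum.Base using (_⊎_; inj₁; inj₂)
open import Data.List.Base using (List; length)
open import Data.List.Membership.Propositional using (_∈_)
open import Data.List.Relation.Unary.Unique.Propositional using (Unique)
open import Data.Empty using (⊥; ⊥-elim)
open import Function.Bundles using (_⇔_)
open import Level using (0ℓ)
open import Relation.Nullary.Decidable using (yes; no)
open import Relation.Unary using (Pred)
open import Relation.Binary.Core using (Rel)
open import Relation.Binary.Definitions using (tri<; tri≈; tri>)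
open import Relation.Binary.PropositionalEquality
  using (_≡_; refl; sym; trans; cong; subst; subst₂)

-- Two-sided Dedekind cuts: L q stands for q < x and U q for x < q.
record ℝ : Set₁ where
  field
    L U         : Pred ℚ 0ℓ
    L-inhabited : ∃ L
    U-inhabited : ∃ U
    L-closed    : ∀ {q r} → q < r → L r → L q
    U-closed    : ∀ {q r} → q < r → U q → U r
    L-open      : ∀ {q} → L q → ∃ λ r → q < r × L r
    U-open      : ∀ {r} → U r → ∃ λ q → q < r × U q
    disjoint    : ∀ {q} → L q → U q → ⊥
    located     : ∀ {q r} → q < r → L q ⊎ U r

  L<U : ∀ {q r} → L q → U r → q < r
  L<U {q} {r} Lq Ur with <-cmp q r
  ... | tri< q<r _ _  = q<r
  ... | tri≈ _ refl _ = ⊥-elim (disjoint Lq Ur)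
  ... | tri> _ _ r<q  = ⊥-elim (disjoint (L-closed r<q Lq) Ur)

open ℝ public

infix 4 _≤ᵣ_ _<ᵣ_

_≤ᵣ_ : Rel ℝ 0ℓ
x ≤ᵣ y = ∀ {q} → L x q → L y q

_<ᵣ_ : Rel ℝ 0ℓ
x <ᵣ y = ∃ λ q → U x q × L y q

fromℚ : ℚ → ℝ
fromℚ p = record
  { L           = _< p
  ; U           = p <_
  ; L-inhabited = p - 1ℚ , subst (p - 1ℚ <_) (+-identityʳ p)
                             (+-monoʳ-< p (negative⁻¹ (- 1ℚ)))
  ; U-inhabited = p + 1ℚ , subst (_< p + 1ℚ) (+-identityʳ p)
                             (+-monoʳ-< p (positive⁻¹ 1ℚ))
  ; L-closed    = <-trans
  ; U-closed    = λ q<r p<q → <-trans p<q q<r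
  ; L-open      = <-dense
  ; U-open      = λ p<r → let q , p<q , q<r = <-dense p<r in q , q<r , p<q
  ; disjoint    = <-asym
  ; located     = loc
  }
  where
  loc : ∀ {q r} → q < r → q < p ⊎ p < r
  loc {q} q<r with q <? p
  ... | yes q<p = inj₁ q<p
  ... | no  q≮p = inj₂ (≤-<-trans (≮⇒≥ q≮p) q<r)

fromℤ : ℤ → ℝ
fromℤ k = fromℚ (k / 1)

IsFloor : ℝ → ℤ → Set
IsFloor x k = fromℤ k ≤ᵣ x × x <ᵣ fromℤ (k ℤ.+ + 1)

-- The image of a real under an increasing bijection f of ℚ with inverse g.
private
  image : (f g : ℚ → ℚ) →
          (∀ {q r} → q < r → f q < f r) → (∀ {q r} → q < r → g q < g r) →
          (∀ q → f (g q) ≡ q) → (∀ q → g (f q) ≡ q) → ℝ → ℝ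
  image f g f-mono g-mono fg gf x = record
    { L           = λ q → L x (g q)
    ; U           = λ q → U x (g q)
    ; L-inhabited = let q , Lq = L-inhabited x
                    in f q , subst (L x) (sym (gf q)) Lq
    ; U-inhabited = let q , Uq = U-inhabited x
                    in f q , subst (U x) (sym (gf q)) Uq
    ; L-closed    = λ q<r → L-closed x (g-mono q<r)
    ; U-closed    = λ q<r → U-closed x (g-mono q<r)
    ; L-open      = λ {q} Lq → let r , gq<r , Lr = L-open x Lq in
                    f r , subst (_< f r) (fg q) (f-mono gq<r)
                        , subst (L x) (sym (gf r)) Lr
    ; U-open      = λ {r} Ur → let q , q<gr , Uq = U-open x Ur in
                    f q , subst (f q <_) (fg r) (f-mono q<gr)
                        , subst (U x) (sym (gf q)) Uq
    ; disjoint    = disjoint x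
    ; located     = λ q<r → located x (g-mono q<r)
    }

infixl 6 _+ᵣ_
infixl 7 _/ᵣ_ _÷ᵣ_

-- The sum of a rational and a real: q < p + x iff q - p < x.
_+ᵣ_ : ℚ → ℝ → ℝ
p +ᵣ x = image (λ q → p + q) (λ q → q - p) (+-monoʳ-< p) (+-monoˡ-< (- p)) fg gf x
  where
  open +-*-Solver
  fg : ∀ q → p + (q - p) ≡ q
  fg q = solve 2 (λ p q → p :+ (q :- p) := q) refl p q
  gf : ∀ q → (p + q) - p ≡ q
  gf q = solve 2 (λ p q → (p :+ q) :- p := q) refl p q

private
  *-÷-cancel : ∀ q p .{{_ : NonZero p}} → q * p * 1/ p ≡ q
  *-÷-cancel q p = trans (*-assoc q p (1/ p))
                     (trans (cong (q *_) (*-inverseʳ p)) (*-identityʳ q))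

  ÷-*-cancel : ∀ q p .{{_ : NonZero p}} → q * 1/ p * p ≡ q
  ÷-*-cancel q p = trans (*-assoc q (1/ p) p)
                     (trans (cong (q *_) (*-inverseˡ p)) (*-identityʳ q))

  *-pos : ∀ {p q} → 0ℚ < p → 0ℚ < q → 0ℚ < p * q
  *-pos {p} {q} 0<p 0<q =
    positive⁻¹ (p * q)
      {{pos*pos⇒pos p {{positive 0<p}} q {{positive 0<q}}}}

  *<⇒<÷ : ∀ {p r} s .{{_ : Positive s}} .{{_ : NonZero s}} →
          p * s < r → p < r * 1/ s
  *<⇒<÷ {p} {r} s ps<r =
    *-cancelʳ-<-nonNeg s {{pos⇒nonNeg s}}
      (subst (p * s <_) (sym (÷-*-cancel r s)) ps<r)

  <*⇒÷< : ∀ {p r} s .{{_ : Positive s}} .{{_ : NonZero s}} →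
          r < p * s → r * 1/ s < p
  <*⇒÷< {p} {r} s r<ps =
    *-cancelʳ-<-nonNeg s {{pos⇒nonNeg s}}
      (subst (_< p * s) (sym (÷-*-cancel r s)) r<ps)

  <÷⇒*< : ∀ {p r} s .{{_ : Positive s}} .{{_ : NonZero s}} →
          p < r * 1/ s → p * s < r
  <÷⇒*< {p} {r} s p<r/s =
    subst (p * s <_) (÷-*-cancel r s) (*-monoˡ-<-pos s p<r/s)

  ÷<⇒<* : ∀ {p r} s .{{_ : Positive s}} .{{_ : NonZero s}} →
          r * 1/ s < p → r < p * s
  ÷<⇒<* {p} {r} s r/s<p =
    subst (_< p * s) (÷-*-cancel r s) (*-monoˡ-<-pos s r/s<p)

-- The quotient of a real by a positive rational: q < x / p iff q * p < x.
_/ᵣ_ : ℝ → (p : ℚ) → .{{Positive p}} → ℝ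
x /ᵣ p = image (λ q → q * 1/ p) (λ q → q * p)
               (*-monoˡ-<-pos (1/ p)) (*-monoˡ-<-pos p)
               (λ q → *-÷-cancel q p) (λ q → ÷-*-cancel q p) x
  where
  instance
    _ = pos⇒nonZero p
    _ = 1/pos⇒pos p

-- The quotient of a positive rational by a positive real:
-- q < p / x iff q * s < p for some s > x.
_÷ᵣ_ : (p : ℚ) .{{_ : Positive p}} (x : ℝ) {0<x : L x 0ℚ} → ℝ
_÷ᵣ_ p x {0<x} = record
  { L           = L÷
  ; U           = U÷
  ; L-inhabited = let s , Us = U-inhabited x
                  in 0ℚ , s , Us , subst (_< p) (sym (*-zeroˡ s)) 0<p
  ; U-inhabited = U÷-inhabited
  ; L-closed    = λ q<r (s , Us , rs<p) →
                    s , Us , <-trans (*-monoˡ-<-pos s {{U⇒pos Us}} q<r) rs<p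
  ; U-closed    = λ q<r (s , 0<s , Ls , p<qs) →
                    s , 0<s , Ls ,
                    <-trans p<qs (*-monoˡ-<-pos s {{positive 0<s}} q<r)
  ; L-open      = L÷-open
  ; U-open      = U÷-open
  ; disjoint    = λ {q} → disj {q}
  ; located     = loc
  }
  where
  0<p : 0ℚ < p
  0<p = positive⁻¹ p

  L÷ U÷ : Pred ℚ 0ℓ
  L÷ q = ∃ λ s → U x s × q * s < p
  U÷ q = ∃ λ s → 0ℚ < s × L x s × p < q * s

  U⇒pos : ∀ {s} → U x s → Positive s
  U⇒pos Us = positive (L<U x 0<x Us)

  U÷-inhabited : ∃ U÷
  U÷-inhabited =
    let s , 0<s , Ls = L-open x 0<x
        instance s⁺  = positive 0<s
                 s≢0 = pos⇒nonZero s
        q , p/s<q    = U-inhabited (fromℚ (p * 1/ s))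
    in q , s , 0<s , Ls , ÷<⇒<* s p/s<q

  L÷-open : ∀ {q} → L÷ q → ∃ λ r → q < r × L÷ r
  L÷-open (s , Us , qs<p) =
    let instance s⁺  = U⇒pos Us
                 s≢0 = pos⇒nonZero s
        r , q<r , r<p/s = <-dense (*<⇒<÷ s qs<p)
    in r , q<r , s , Us , <÷⇒*< s r<p/s

  U÷-open : ∀ {r} → U÷ r → ∃ λ q → q < r × U÷ q
  U÷-open (s , 0<s , Ls , p<rs) =
    let instance s⁺  = positive 0<s
                 s≢0 = pos⇒nonZero s
        q , p/s<q , q<r = <-dense (<*⇒÷< s p<rs)
    in q , q<r , s , 0<s , Ls , ÷<⇒<* s p/s<q

  disj : ∀ {q} → L÷ q → U÷ q → ⊥
  disj {q} (s , Us , qs<p) (t , 0<t , Lt , p<qt) =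
    <-asym (<-trans qs<p p<qt) (*-monoʳ-<-pos q {{positive 0<q}} (L<U x Lt Us))
    where
    0<q : 0ℚ < q
    0<q = *-cancelʳ-<-nonNeg t {{pos⇒nonNeg t {{positive 0<t}}}}
            (subst (_< q * t) (sym (*-zeroˡ t)) (<-trans 0<p p<qt))

  loc : ∀ {q r} → q < r → L÷ q ⊎ U÷ r
  loc {q} {r} q<r with 0ℚ <? q
  ... | no  0≮q =
    let s , Us = U-inhabited x
        qs≤0 = subst (q * s ≤_) (*-zeroˡ s)
                 (*-monoʳ-≤-nonNeg s {{pos⇒nonNeg s {{U⇒pos Us}}}} (≮⇒≥ 0≮q))
    in inj₁ (s , Us , ≤-<-trans qs≤0 0<p)
  ... | yes 0<q = choose (located x a<b)
    where
    0<r = <-trans 0<q q<r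
    instance
      q⁺  = positive 0<q
      q≢0 = pos⇒nonZero q
      r⁺  = positive 0<r
      r≢0 = pos⇒nonZero r
    0<p/r : 0ℚ < p * 1/ r
    0<p/r = *-pos 0<p (positive⁻¹ (1/ r) {{1/pos⇒pos r}})
    p/r<p/q : p * 1/ r < p * 1/ q
    p/r<p/q = *<⇒<÷ q (subst (p * 1/ r * q <_) (÷-*-cancel p r)
                (*-monoʳ-<-pos (p * 1/ r) {{positive 0<p/r}} q<r))
    first  = <-dense p/r<p/q
    a      = proj₁ first
    p/r<a  = proj₁ (proj₂ first)
    second = <-dense (proj₂ (proj₂ first))
    b      = proj₁ second
    a<b    = proj₁ (proj₂ second)
    b<p/q  = proj₂ (proj₂ second)
    choose : L x a ⊎ U x b → L÷ q ⊎ U÷ r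
    choose (inj₁ La) = inj₂ (a , <-trans 0<p/r p/r<a , La ,
                             subst (p <_) (*-comm a r) (÷<⇒<* r p/r<a))
    choose (inj₂ Ub) = inj₁ (b , Ub ,
                             subst (_< p) (*-comm b q) (<÷⇒*< q b<p/q))

-- The positive square root of a positive rational.
√ : (p : ℚ) → .{{Positive p}} → ℝ
√ p = record
  { L           = L√
  ; U           = U√
  ; L-inhabited = - 1ℚ , inj₁ (negative⁻¹ (- 1ℚ))
  ; U-inhabited = c , 0<c , p<cc
  ; L-closed    = L√-closed
  ; U-closed    = λ q<r (0<q , p<qq) →
                    <-trans 0<q q<r , <-trans p<qq (square-mono (<⇒≤ 0<q) q<r)
  ; L-open      = L√-open
  ; U-open      = U√-open
  ; disjoint    = λ {q} → disj {q}
  ; located     = loc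
  }
  where
  L√ U√ : Pred ℚ 0ℓ
  L√ q = q < 0ℚ ⊎ q * q < p
  U√ q = 0ℚ < q × p < q * q

  0<p : 0ℚ < p
  0<p = positive⁻¹ p

  square-mono : ∀ {q r} → 0ℚ ≤ q → q < r → q * q < r * r
  square-mono {q} {r} 0≤q q<r =
    ≤-<-trans (*-monoˡ-≤-nonNeg q {{nonNegative 0≤q}} (<⇒≤ q<r))
              (*-monoˡ-<-pos r {{positive (≤-<-trans 0≤q q<r)}} q<r)

  c : ℚ
  c = p + 1ℚ

  0<c : 0ℚ < c
  0<c = +-mono-< 0<p (positive⁻¹ 1ℚ)

  module _ where
    open +-*-Solver

    0<d⇒< : ∀ {q r d} → 0ℚ < d → q + d ≡ r → q < r
    0<d⇒< {q} {r} {d} 0<d refl =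
      subst (_< q + d) (+-identityʳ q) (+-monoʳ-< q 0<d)

    p<cc : p < c * c
    p<cc = 0<d⇒< {d = p * p + p + 1ℚ}
      (+-mono-< (+-mono-< (*-pos 0<p 0<p) 0<p) (positive⁻¹ 1ℚ))
      (solve 1 (λ p → p :+ (p :* p :+ p :+ con 1ℚ)
                   := (p :+ con 1ℚ) :* (p :+ con 1ℚ)) refl p)

    0<r-q : ∀ {q r} → q < r → 0ℚ < r - q
    0<r-q {q} {r} q<r =
      subst (_< r - q) (+-inverseʳ q) (+-monoˡ-< (- q) q<r)

    -- For q ≥ 0 the number s = (c q + p) / (q + c) lies strictly between
    -- q and √ p: writing e = 1 / (q + c),
    -- s - q = (p - q²) e  and  p - s² = (c² - p) (p - q²) e².
    module Improve {q} (0≤q : 0ℚ ≤ q) where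
      0<q+c : 0ℚ < q + c
      0<q+c = +-mono-≤-< 0≤q 0<c

      instance
        q+c⁺  = positive 0<q+c
        q+c≢0 = pos⇒nonZero (q + c)

      e : ℚ
      e = 1/ (q + c)

      0<e : 0ℚ < e
      0<e = positive⁻¹ e {{1/pos⇒pos (q + c)}}

      s : ℚ
      s = (c * q + p) * e

      0<s : 0ℚ < s
      0<s = *-pos (+-mono-≤-< 0≤cq 0<p) 0<e
        where
        0≤cq : 0ℚ ≤ c * q
        0≤cq = subst (_≤ c * q) (*-zeroʳ c)
                 (*-monoˡ-≤-nonNeg c {{nonNegative (<⇒≤ 0<c)}} 0≤q)

      q≡ : q ≡ (q * (q + c)) * e
      q≡ = sym (*-÷-cancel q (q + c))

      p≡ : p ≡ (p * (q + c) * (q + c)) * e * e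
      p≡ = sym (trans
        (solve 3 (λ p t e → (p :* t :* t) :* e :* e := p :* (t :* e) :* (t :* e))
               refl p (q + c) e)
        (trans (cong (λ z → p * z * z) (*-inverseʳ (q + c)))
               (solve 1 (λ p → p :* con 1ℚ :* con 1ℚ := p) refl p)))

      s-below : q * q < p → q < s
      s-below qq<p = 0<d⇒< (*-pos (0<r-q qq<p) 0<e)
        (trans (cong (_+ (p - q * q) * e) q≡)
          (solve 4 (λ p q c e → (q :* (q :+ c)) :* e :+ (p :- q :* q) :* e
                             := (c :* q :+ p) :* e) refl p q c e))

      s-above : p < q * q → s < q
      s-above p<qq = 0<d⇒< (*-pos (0<r-q p<qq) 0<e)
        (trans
          (solve 4 (λ p q c e → (c :* q :+ p) :* e :+ (q :* q :- p) :* e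
                             := (q :* (q :+ c)) :* e) refl p q c e)
          (sym q≡))

      ss<p : q * q < p → s * s < p
      ss<p qq<p = 0<d⇒< (*-pos (*-pos (*-pos (0<r-q p<cc) (0<r-q qq<p)) 0<e) 0<e)
        (trans
          (solve 4 (λ p q c e →
              (c :* q :+ p) :* e :* ((c :* q :+ p) :* e)
                :+ (c :* c :- p) :* (p :- q :* q) :* e :* e
              := (p :* (q :+ c) :* (q :+ c)) :* e :* e) refl p q c e)
          (sym p≡))

      p<ss : p < q * q → p < s * s
      p<ss p<qq = 0<d⇒< (*-pos (*-pos (*-pos (0<r-q p<cc) (0<r-q p<qq)) 0<e) 0<e)
        (trans (cong (_+ (c * c - p) * (q * q - p) * e * e) p≡)
          (solve 4 (λ p q c e →
              (p :* (q :+ c) :* (q :+ c)) :* e :* e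
                :+ (c :* c :- p) :* (q :* q :- p) :* e :* e
              := (c :* q :+ p) :* e :* ((c :* q :+ p) :* e)) refl p q c e))

  L√-closed : ∀ {q r} → q < r → L√ r → L√ q
  L√-closed {q} q<r L√r with q <? 0ℚ
  ... | yes q<0 = inj₁ q<0
  L√-closed q<r (inj₁ r<0)  | no _   = inj₁ (<-trans q<r r<0)
  L√-closed q<r (inj₂ rr<p) | no q≮0 =
    inj₂ (<-trans (square-mono (≮⇒≥ q≮0) q<r) rr<p)

  L√-open : ∀ {q} → L√ q → ∃ λ r → q < r × L√ r
  L√-open (inj₁ q<0) = 0ℚ , q<0 , inj₂ 0<p
  L√-open {q} (inj₂ qq<p) with q <? 0ℚ
  ... | yes q<0 = 0ℚ , q<0 , inj₂ 0<p
  ... | no  q≮0 = s , s-below qq<p , inj₂ (ss<p qq<p)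
    where open Improve (≮⇒≥ q≮0)

  U√-open : ∀ {r} → U√ r → ∃ λ q → q < r × U√ q
  U√-open (0<r , p<rr) = s , s-above p<rr , 0<s , p<ss p<rr
    where open Improve (<⇒≤ 0<r)

  disj : ∀ {q} → L√ q → U√ q → ⊥
  disj (inj₁ q<0)  (0<q , _)    = <-asym q<0 0<q
  disj (inj₂ qq<p) (_   , p<qq) = <-asym qq<p p<qq

  loc : ∀ {q r} → q < r → L√ q ⊎ U√ r
  loc {q} q<r with q <? 0ℚ | q * q <? p
  ... | yes q<0 | _        = inj₁ (inj₁ q<0)
  ... | no  _   | yes qq<p = inj₁ (inj₂ qq<p)
  ... | no  q≮0 | no qq≮p  =
    inj₂ ( ≤-<-trans (≮⇒≥ q≮0) q<r
         , ≤-<-trans (≮⇒≥ qq≮p) (square-mono (≮⇒≥ q≮0) q<r))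

φ : ℝ
φ = (1ℚ +ᵣ √ (+ 5 / 1)) /ᵣ (+ 2 / 1)

0<φ : L φ 0ℚ
0<φ = inj₁ (negative⁻¹ (- 1ℚ))

_/φ : (m : ℕ) .{{_ : ℕ.NonZero m}} → ℝ
m /φ = _÷ᵣ_ (+ m / 1) {{normalize-pos m 1}} φ {0<φ}

-- P- and N-positions of a game under normal play.  Being inductive, the
-- definition only admits positions whose outcome is forced after finitely
-- many moves.
module Outcome {Position : Set} (_⟶_ : Rel Position 0ℓ) where
  mutual
    data IsP (p : Position) : Set where
      isP : (∀ {q} → p ⟶ q → IsN q) → IsP p

    data IsN (p : Position) : Set where
      isN : ∀ {q} → p ⟶ q → IsP q → IsN p

HasCardinality : {A : Set} → Pred A 0ℓ → ℕ → Set
HasCardinality P n =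
  ∃ λ xs → Unique xs × (∀ x → x ∈ xs ⇔ P x) × length xs ≡ n

module Wythoff (m : ℕ) .{{_ : ℕ.NonZero m}} where
  Position : Set
  Position = ℕ × ℕ

  data _⟶_ : Rel Position 0ℓ where
    first  : ∀ {p₁ p₂ q₁ k} → 0 ℕ.< k → p₁ ≡ q₁ ℕ.+ k →
             (p₁ , p₂) ⟶ (q₁ , p₂)
    second : ∀ {p₁ p₂ q₂ k} → 0 ℕ.< k → p₂ ≡ q₂ ℕ.+ k →
             (p₁ , p₂) ⟶ (p₁ , q₂)
    both   : ∀ {p₁ p₂ q₁ q₂ k₁ k₂} → 0 ℕ.< k₁ → 0 ℕ.< k₂ →
             k₁ % m ≡ k₂ % m → p₁ ≡ q₁ ℕ.+ k₁ → p₂ ≡ q₂ ℕ.+ k₂ →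
             (p₁ , p₂) ⟶ (q₁ , q₂)

  open Outcome _⟶_ public

module Submission where

-- As in Wythoff's original game, the P-positions are pairs (A n , B n) and
-- (B n , A n) with A n = ⌊n φ⌋ and B n = ⌊n φ²⌋, but only for n ≤ k = ⌊m / φ⌋.
-- Two such pairs with indices i and n are joined by a new modular move only if
-- i + n = m, and then A n ≤ B i exactly because n ≤ k, so the move would not
-- decrease both piles.  Conversely, k is large enough that every residue modulo m
-- is the difference of a pair that lies strictly below all the positions whose
-- piles both avoid A 0, B 0, …, A k, B k.

open import Defs
open import Data.Product
open import Data.Sum using (_⊎_; inj₁; inj₂)
open import Data.List using (List; []; _∷_; length)
open import Data.List.Membership.Propositional using (_∈_)
open import Data.List.Relation.Unary.Any using (here; there)
open import Data.List.Relation.Unary.All as All using ([]; _∷_)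
open import Data.List.Relation.Unary.AllPairs using ([]; _∷_)
open import Data.List.Relation.Unary.Unique.Propositional using (Unique)
open import Data.Product.Properties using (,-injectiveˡ)
open import Function using (_∘_; mk⇔)
open import Induction.WellFounded using (Acc; acc)
open import Relation.Binary.Definitions using (tri<; tri≈; tri>)
open import Relation.Binary.PropositionalEquality
open import Relation.Nullary using (¬_; Dec; yes; no; contradiction)
open import Relation.Nullary.Decidable using (map′)

-- The floor of m / φ, read off from the Dedekind cuts.

module GoldenRatio where
  open import Data.Nat.Base as ℕ using (ℕ; zero; suc)
  import Data.Nat.Properties as ℕ
  open import Data.Integer.Base as ℤ using (+_)
  import Data.Integer.Properties as ℤ
  open import Data.Nat.Coprimality using (1-coprimeTo) renaming (sym to coprime-sym)
  open import Data.Rational.Base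
  open import Data.Rational.Properties
  open import Data.Rational.Solver using (module +-*-Solver)

  ι : ℕ → ℚ
  ι n = + n / 1

  -- Rewriting to the normal form exposes numerator and denominator, so rational operations on `ι`
  -- compute to integer ones.
  ι≡mkℚ : ∀ n → ι n ≡ mkℚ (+ n) 0 (coprime-sym (1-coprimeTo n))
  ι≡mkℚ n = ↥p/↧p≡p (mkℚ (+ n) 0 (coprime-sym (1-coprimeTo n)))

  ι-* : ∀ a b → ι a * ι b ≡ ι (a ℕ.* b)
  ι-* a b rewrite ι≡mkℚ a | ι≡mkℚ b = cong (_/ 1) (sym (ℤ.pos-* a b))

  ι-+ : ∀ a b → ι a + ι b ≡ ι (a ℕ.+ b)
  ι-+ a b rewrite ι≡mkℚ a | ι≡mkℚ b =
    cong (_/ 1) (cong₂ ℤ._+_ (ℤ.*-identityʳ (+ a)) (ℤ.*-identityʳ (+ b)))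

  ι-< : ∀ {a b} → a ℕ.< b → ι a < ι b
  ι-< {a} {b} a<b rewrite ι≡mkℚ a | ι≡mkℚ b =
    *<* (ℤ.*-monoʳ-<-pos (+ 1) (ℤ.+<+ a<b))

  1<s⇒0<2s-1 : ∀ {s} → 1ℚ < s → 0ℚ < s * (+ 2 / 1) - 1ℚ
  1<s⇒0<2s-1 1<s = <-trans (positive⁻¹ 1ℚ)
    (+-monoˡ-< (- 1ℚ) (*-monoˡ-<-pos (+ 2 / 1) 1<s))

  -- (2 s - 1)² - 5 = 4 (s² - s - 1).
  module _ (s : ℚ) where
    private
      2s-1 = s * (+ 2 / 1) - 1ℚ
      shift : ℚ → ℚ
      shift x = x * (+ 4 / 1) + (1ℚ - s * (+ 4 / 1))
      shift-mono : ∀ {x y} → x < y → shift x < shift y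
      shift-mono x<y = +-monoˡ-< (1ℚ - s * (+ 4 / 1)) (*-monoˡ-<-pos (+ 4 / 1) x<y)
      open +-*-Solver
      shift-square : shift (s * s) ≡ 2s-1 * 2s-1
      shift-square = solve 1 (λ s →
        s :* s :* con (+ 4 / 1) :+ (con 1ℚ :- s :* con (+ 4 / 1)) :=
        (s :* con (+ 2 / 1) :- con 1ℚ) :* (s :* con (+ 2 / 1) :- con 1ℚ)) refl s
      shift-linear : shift (1ℚ + s) ≡ + 5 / 1
      shift-linear = solve 1 (λ s →
        (con 1ℚ :+ s) :* con (+ 4 / 1) :+ (con 1ℚ :- s :* con (+ 4 / 1)) :=
        con (+ 5 / 1)) refl s

    L-φ : s * s < 1ℚ + s → L φ s
    L-φ lt = inj₂ (subst₂ _<_ shift-square shift-linear (shift-mono lt))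

    U-φ : 1ℚ < s → 1ℚ + s < s * s → U φ s
    U-φ 1<s lt = 1<s⇒0<2s-1 1<s , subst₂ _<_ shift-linear shift-square (shift-mono lt)

  -- Comparing m / φ with k + 1 amounts to comparing s = m / (k + 1) with φ. Scaling s² and 1 + s by
  -- (k + 1)² makes that an inequality between naturals.
  module Ratio (m k : ℕ) where
    private
      M = ι m
      K = ι (suc k)
      instance
        K⁺ : Positive K
        K⁺ = normalize-pos (suc k) 1
        K≢0 : NonZero K
        K≢0 = pos⇒nonZero K

    s : ℚ
    s = M * 1/ K

    s*K≡M : s * K ≡ M
    s*K≡M = trans (*-assoc M (1/ K) K)
      (trans (cong (M *_) (*-inverseˡ K)) (*-identityʳ M))

    private
      cancel-K : ∀ {x y} → x * K < y * K → x < y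
      cancel-K = *-cancelʳ-<-nonNeg K {{pos⇒nonNeg K}}

      open +-*-Solver
      square : ι (m ℕ.* m) ≡ s * s * K * K
      square = trans (sym (ι-* m m)) (trans (cong (λ M → M * M) (sym s*K≡M))
        (solve 2 (λ s K → s :* K :* (s :* K) := s :* s :* K :* K) refl s K))
      linear : ι (suc k ℕ.* (suc k ℕ.+ m)) ≡ (1ℚ + s) * K * K
      linear = trans (sym (ι-* (suc k) (suc k ℕ.+ m)))
        (trans (cong (K *_) (trans (sym (ι-+ (suc k) m)) (cong (_+_ K) (sym s*K≡M))))
        (solve 2 (λ s K → K :* (K :+ s :* K) := (con 1ℚ :+ s) :* K :* K) refl s K))

    0<s : 0 ℕ.< m → 0ℚ < s
    0<s 0<m = cancel-K (subst₂ _<_ (sym (*-zeroˡ K)) (sym s*K≡M) (ι-< 0<m))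

    1<s : suc k ℕ.< m → 1ℚ < s
    1<s k<m = cancel-K (subst₂ _<_ (sym (*-identityˡ K)) (sym s*K≡M) (ι-< k<m))

    s<φ : m ℕ.* m ℕ.< suc k ℕ.* (suc k ℕ.+ m) → L φ s
    s<φ lt = L-φ s (cancel-K (cancel-K (subst₂ _<_ square linear (ι-< lt))))

    φ<s : suc k ℕ.< m → suc k ℕ.* (suc k ℕ.+ m) ℕ.< m ℕ.* m → U φ s
    φ<s k<m lt = U-φ s (1<s k<m) (cancel-K (cancel-K (subst₂ _<_ linear square (ι-< lt))))

  module _ (m : ℕ) .{{_ : ℕ.NonZero m}} (0<m : 0 ℕ.< m) where
    -- For a positive bound the witness is the ratio m / k itself, which exceeds φ. For the bound 0
    -- any s above φ works, since q * s < 0 < m.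
    below : ∀ k → k ℕ.< m → k ℕ.* (k ℕ.+ m) ℕ.< m ℕ.* m →
            ∀ {q} → q < ι k → L (m /φ) q
    below zero _ _ {q} q<0 =
      let s , φ<s = U-inhabited φ in
      s , φ<s ,
      <-trans (subst (q * s <_) (*-zeroˡ s)
                (*-monoˡ-<-pos s {{positive (L<U φ {0ℚ} {s} 0<φ φ<s)}} q<0))
              (ι-< 0<m)
    below (suc k) k<m lt {q} q<k =
      s , φ<s k<m lt ,
      subst (q * s <_) (trans (*-comm (ι (suc k)) s) s*K≡M)
        (*-monoˡ-<-pos s {{positive (0<s 0<m)}} q<k)
      where open Ratio m k

    above : ∀ k → m ℕ.* m ℕ.< suc k ℕ.* (suc k ℕ.+ m) → U (m /φ) (ι (suc k))
    above k lt =
      -- At s itself (k + 1) s equals m; a t strictly between s and φ makes the inequality strict.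
      let t , s<t , t<φ = L-open φ (s<φ lt) in
      t , <-trans (0<s 0<m) s<t , t<φ ,
      subst (_< ι (suc k) * t) (trans (*-comm (ι (suc k)) s) s*K≡M)
        (*-monoʳ-<-pos (ι (suc k)) {{normalize-pos (suc k) 1}} s<t)
      where open Ratio m k

    floor-÷φ : ∀ k → k ℕ.< m → k ℕ.* (k ℕ.+ m) ℕ.< m ℕ.* m →
               m ℕ.* m ℕ.< suc k ℕ.* (suc k ℕ.+ m) → IsFloor (m /φ) (+ k)
    floor-÷φ k k<m lower upper = below k k<m lower , floor<
      where
      floor< : m /φ <ᵣ fromℤ (+ (k ℕ.+ 1))
      floor< =
        let q , q<k+1 , Uq = U-open (m /φ)
              (subst (λ n → U (m /φ) (ι n)) (ℕ.+-comm 1 k) (above k upper))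
        in q , Uq , q<k+1

-- Integer arithmetic of comparisons with φ.

open import Data.Nat
open import Data.Nat.Divisibility using (_∣_; divides; ∣m+n∣m⇒∣n; ∣⇒≤)
open import Data.Nat.DivMod using (_%_; _/_; m≡m%n+[m/n]*n; m%n<n; [m+kn]%n≡m%n)
open import Data.Nat.Induction using (<-wellFounded)
open import Data.Nat.Properties
open import Data.Nat.Tactic.RingSolver using (solve-∀)

infix 4 _⊑_

-- y ⊑ n says y φ ≤ n: this is the condition y² + y n ≤ n² on y / n ≥ 0.
record _⊑_ (y n : ℕ) : Set where
  constructor mk⊑
  field quadratic : y * (y + n) ≤ n * n

open _⊑_

_⊑?_ : ∀ y n → Dec (y ⊑ n)
y ⊑? n = map′ mk⊑ quadratic (y * (y + n) ≤? n * n)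

⊑-downward : ∀ {y z n} → y ≤ z → z ⊑ n → y ⊑ n
⊑-downward {n = n} y≤z (mk⊑ z⊑n) =
  mk⊑ (≤-trans (*-mono-≤ y≤z (+-monoˡ-≤ n y≤z)) z⊑n)

suc⋢ : ∀ n → ¬ suc n ⊑ n
suc⋢ n = <⇒≱ (*-mono-< (n<1+n n) (m≤m+n (suc n) n)) ∘ quadratic

⊑⇒≤ : ∀ {y n} → y ⊑ n → y ≤ n
⊑⇒≤ {y} {n} y⊑n with y ≤? n
... | yes y≤n = y≤n
... | no  y≰n = contradiction (⊑-downward (≰⇒> y≰n) y⊑n) (suc⋢ n)

n⋢n : ∀ {n} → 0 < n → ¬ n ⊑ n
n⋢n {n@(suc _)} _ = <⇒≱ (*-monoʳ-< n (m<m+n n z<s)) ∘ quadratic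

-- Raising n by e adds y e on the left and at least n e on the right, and y ≤ n.
⊑-upward : ∀ {y n n′} → n ≤ n′ → y ⊑ n → y ⊑ n′
⊑-upward {y} {n} n≤n′ y⊑n with m≤n⇒∃[o]m+o≡n n≤n′
... | e , refl = mk⊑ (begin
  y * (y + (n + e))              ≡⟨ expand y n e ⟩
  y * (y + n) + y * e            ≤⟨ +-mono-≤ (quadratic y⊑n) (*-monoˡ-≤ e (⊑⇒≤ y⊑n)) ⟩
  n * n + n * e                  ≤⟨ m≤m+n _ _ ⟩
  n * n + n * e + (n + e) * e    ≡⟨ collect n e ⟩
  (n + e) * (n + e)              ∎)
  where
  open ≤-Reasoning
  expand : ∀ y n e → y * (y + (n + e)) ≡ y * (y + n) + y * e
  expand = solve-∀
  collect : ∀ n e → n * n + n * e + (n + e) * e ≡ (n + e) * (n + e)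
  collect = solve-∀

-- Irrationality of φ by descent: if y² = d (d + y) then y = d + e with
-- d² = e (e + d).
φ-irrational : ∀ d {y} → y * y ≡ d * (d + y) → y ≡ 0
φ-irrational d = go d (<-wellFounded d)
  where
  cancel-eq : ∀ d e → (d + e) * (d + e) ≡ d * (d + (d + e)) → d * d ≡ e * (e + d)
  cancel-eq d e eq = sym (+-cancelˡ-≡ (d * d + d * e) _ _
    (trans (lhs d e) (trans eq (rhs d e))))
    where
    lhs : ∀ d e → d * d + d * e + e * (e + d) ≡ (d + e) * (d + e)
    lhs = solve-∀
    rhs : ∀ d e → d * (d + (d + e)) ≡ d * d + d * e + d * d
    rhs = solve-∀
  go : ∀ d → Acc _<_ d → ∀ {y} → y * y ≡ d * (d + y) → y ≡ 0
  go zero      _         {zero}  eq = refl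
  go d@(suc _) (acc rec) {y} eq with d ≤? y
  ... | no d≰y = contradiction eq (<⇒≢ (*-mono-< (≰⇒> d≰y) (m<n+m y z<s)))
  ... | yes d≤y with m≤n⇒∃[o]m+o≡n d≤y
  ...   | zero  , refl = contradiction (cancel-eq d 0 eq) λ ()
  -- In the smaller equation `d` plays the role of `y`, so the recursive call yields `d ≡ 0`,
  -- impossible for a successor.
  ...   | e@(suc e′) , refl = contradiction (go e (rec e<d) (cancel-eq d e eq)) λ ()
    where
    e<d : e < d
    e<d = ≰⇒> λ d≤e → <⇒≢ (≤-<-trans (*-monoˡ-≤ d d≤e) (*-monoʳ-< e (m<n+m d z<s)))
                           (cancel-eq d e eq)

-- Since φ (φ - 1) = 1, y φ ≤ y + d iff y ≤ d φ, which by irrationality is the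
-- negation of d φ ≤ y when y > 0.
module _ where
  private
    balance : ∀ y d → y * (y + (y + d)) + d * (d + y) ≡ (y + d) * (y + d) + y * y
    balance = solve-∀

  ⋢⇒⊑+ : ∀ {y d} → ¬ d ⊑ y → y ⊑ y + d
  ⋢⇒⊑+ {y} {d} d⋢y = mk⊑ (+-cancelʳ-≤ (y * y) _ _
    (≤-trans (+-monoʳ-≤ _ (<⇒≤ (≰⇒> (d⋢y ∘ mk⊑)))) (≤-reflexive (balance y d))))

  ⊑⇒⋢+ : ∀ {y d} → 0 < y → d ⊑ y → ¬ y ⊑ y + d
  ⊑⇒⋢+ {y@(suc _)} {d} 0<y d⊑y y⊑y+d = contradiction (φ-irrational d (≤-antisym
      (+-cancelˡ-≤ (y * (y + (y + d))) _ _ (≤-trans (+-monoˡ-≤ (y * y) (quadratic y⊑y+d))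
        (≤-reflexive (sym (balance y d)))))
      (quadratic d⊑y))) λ ()

-- Wythoff's sequences, their order and Beatty's theorem.

greatest : ∀ {P : ℕ → Set} → (∀ y → Dec (P y)) → P 0 →
           ∀ N → ¬ P (suc N) → ∃ λ y → P y × ¬ P (suc y)
greatest P? P0 zero    ¬P1 = 0 , P0 , ¬P1
greatest P? P0 (suc N) ¬PN with P? (suc N)
... | yes PN  = suc N , PN , ¬PN
... | no ¬PN′ = greatest P? P0 N ¬PN′

-- c n, A n and B n are ⌊n / φ⌋, ⌊n φ⌋ and ⌊n φ²⌋.
abstract
  c : ℕ → ℕ
  c n = proj₁ (greatest (_⊑? n) (mk⊑ z≤n) n (suc⋢ n))

  c⊑ : ∀ n → c n ⊑ n
  c⊑ n = proj₁ (proj₂ (greatest (_⊑? n) (mk⊑ z≤n) n (suc⋢ n)))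

  suc-c⋢ : ∀ n → ¬ suc (c n) ⊑ n
  suc-c⋢ n = proj₂ (proj₂ (greatest (_⊑? n) (mk⊑ z≤n) n (suc⋢ n)))

⊑⇒≤c : ∀ {y n} → y ⊑ n → y ≤ c n
⊑⇒≤c {n = n} y⊑n = ≮⇒≥ λ c<y → suc-c⋢ n (⊑-downward c<y y⊑n)

≤c⇒⊑ : ∀ {y n} → y ≤ c n → y ⊑ n
≤c⇒⊑ {n = n} y≤c = ⊑-downward y≤c (c⊑ n)

⋢⇒c< : ∀ {y n} → ¬ y ⊑ n → c n < y
⋢⇒c< y⋢n = ≰⇒> λ y≤c → y⋢n (≤c⇒⊑ y≤c)

c<⇒⋢ : ∀ {y n} → c n < y → ¬ y ⊑ n
c<⇒⋢ c<y y⊑n = <⇒≱ c<y (⊑⇒≤c y⊑n)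

c-mono : ∀ {i n} → i ≤ n → c i ≤ c n
c-mono {i} i≤n = ⊑⇒≤c (⊑-upward i≤n (c⊑ i))

c≤ : ∀ n → c n ≤ n
c≤ n = ⊑⇒≤ (c⊑ n)

c< : ∀ {n} → 0 < n → c n < n
c< 0<n = ⋢⇒c< (n⋢n 0<n)

A B : ℕ → ℕ
A n = n + c n
B n = A n + n

A-mono-≤ : ∀ {i n} → i ≤ n → A i ≤ A n
A-mono-≤ i≤n = +-mono-≤ i≤n (c-mono i≤n)

A-mono-< : ∀ {i n} → i < n → A i < A n
A-mono-< i<n = +-mono-<-≤ i<n (c-mono (<⇒≤ i<n))

mono-<⇒injective : ∀ {f : ℕ → ℕ} → (∀ {i n} → i < n → f i < f n) →
                   ∀ {i n} → f i ≡ f n → i ≡ n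
mono-<⇒injective f-mono {i} {n} eq with <-cmp i n
... | tri< i<n _ _ = contradiction eq (<⇒≢ (f-mono i<n))
... | tri≈ _ i≡n _ = i≡n
... | tri> _ _ n<i = contradiction (sym eq) (<⇒≢ (f-mono n<i))

A-injective : ∀ {i n} → A i ≡ A n → i ≡ n
A-injective = mono-<⇒injective A-mono-<

B-injective : ∀ {i n} → B i ≡ B n → i ≡ n
B-injective = mono-<⇒injective λ i<n → +-mono-<-≤ (A-mono-< i<n) (<⇒≤ i<n)

-- Compare `A j + j` with `n + c n` termwise: j φ ≤ n gives `j ≤ c n`, and for j > 0 irrationality
-- gives ⌊j φ⌋ < n.
⊑⇒B<A : ∀ {j n} → 0 < n → j ⊑ n → B j < A n
⊑⇒B<A {zero}      {n} 0<n j⊑n rewrite n≤0⇒n≡0 (c≤ 0) = ≤-trans 0<n (m≤m+n n (c n))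
⊑⇒B<A {j@(suc _)} {n} 0<n j⊑n = +-mono-<-≤ A<n (⊑⇒≤c j⊑n)
  where
  A<n : A j < n
  A<n = ≰⇒> λ n≤A → ⊑⇒⋢+ z<s (c⊑ j) (⊑-upward n≤A j⊑n)

-- Termwise again: `c n < j`, and `A j < n` would give j φ ≤ ⌊j φ⌋ + 1 ≤ n.
⋢⇒A≤B : ∀ {j n} → ¬ j ⊑ n → A n ≤ B j
⋢⇒A≤B {j} {n} j⋢n = +-mono-≤ n≤Aj (<⇒≤ (⋢⇒c< j⋢n))
  where
  n≤Aj : n ≤ A j
  n≤Aj = ≮⇒≥ λ A<n → j⋢n (⊑-upward A<n
    (subst (j ⊑_) (+-suc j (c j)) (⋢⇒⊑+ (suc-c⋢ j))))

-- A n < B i when n ≤ A i, and A n > B i when n > A i.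
A≢B : ∀ {n i} → 0 < i → A n ≢ B i
A≢B {n} {i} 0<i eq with n ≤? A i
... | no n≰A = <⇒≢ (⊑⇒B<A (≤-<-trans z≤n (≰⇒> n≰A)) i⊑n) (sym eq)
  where
  i⊑n : i ⊑ n
  i⊑n = ⊑-upward (≰⇒> n≰A) (subst (i ⊑_) (+-suc i (c i)) (⋢⇒⊑+ (suc-c⋢ i)))
... | yes n≤A = <⇒≢ (+-mono-≤-< n≤A (⋢⇒c< i⋢n)) eq
  where
  i⋢n : ¬ i ⊑ n
  i⋢n i⊑n = ⊑⇒⋢+ 0<i (c⊑ i) (⊑-upward n≤A i⊑n)

-- Beatty's theorem for φ and φ²: with j = ⌊(p + 1) / φ⌋, p is either
-- ⌊j φ⌋ or ⌊(p - j) φ²⌋.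
data Covered (p : ℕ) : Set where
  isA : ∀ n → p ≡ A n → Covered p
  isB : ∀ n → p ≡ B n → Covered p

cover : ∀ p → Covered p
cover p with m≤n⇒∃[o]m+o≡n (≤-pred (c< (z<s {p})))
... | i , j+i≡p = helper
  where
  j = c (suc p)
  -- With p = j + i, maximality of j bounds i above by `c (suc j)`, and `j ⊑ suc p` bounds it below
  -- by `c j`.
  i≤c[1+j] : i ≤ c (suc j)
  i≤c[1+j] = ≮⇒≥ λ c<i → suc-c⋢ (suc p)
    (subst (suc j ⊑_) (cong suc j+i≡p) (⋢⇒⊑+ (c<⇒⋢ c<i)))
  cj≤i : c j ≤ i
  cj≤i with j ≟ 0
  ... | yes j≡0 rewrite j≡0 = ≤-trans (c≤ 0) z≤n
  ... | no  j≢0 = ≤-pred (⋢⇒c< λ 1+i⊑j → ⊑⇒⋢+ (n≢0⇒n>0 j≢0) 1+i⊑j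
    (subst (j ⊑_) (trans (cong suc (sym j+i≡p)) (sym (+-suc j i))) (c⊑ (suc p))))
  helper : Covered p
  helper with c j ≟ i
  ... | yes cj≡i = isA j (trans (sym j+i≡p) (cong (j +_) (sym cj≡i)))
  ... | no  cj≢i with ≤∧≢⇒< cj≤i cj≢i
  -- Now j < i φ ≤ j + 1, so j = ⌊i φ⌋ = `A i` and p = `A i + i`. The remaining steps check this as
  -- `e ≡ c i` for e = j - i.
  ...   | cj<i with m≤n⇒∃[o]m+o≡n (≤-pred (≤-<-trans i≤c[1+j] (c< z<s)))
  ...     | e , i+e≡j = isB i (trans (sym j+i≡p)
                          (cong (_+ i) (trans (sym i+e≡j) (cong (i +_) e≡ci))))
    where
    0<i : 0 < i
    0<i = ≤-<-trans z≤n cj<i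
    e≤ci : e ≤ c i
    e≤ci = ≮⇒≥ λ ci<e → c<⇒⋢ cj<i (subst (i ⊑_) i+e≡j (⋢⇒⊑+ (c<⇒⋢ ci<e)))
    ci≤e : c i ≤ e
    ci≤e = ≤-pred (⋢⇒c< λ 1+e⊑i → ⊑⇒⋢+ 0<i 1+e⊑i
      (subst (i ⊑_) (trans (cong suc (sym i+e≡j)) (sym (+-suc i e))) (≤c⇒⊑ i≤c[1+j])))
    e≡ci : e ≡ c i
    e≡ci = ≤-antisym e≤ci ci≤e

-- Congruences, and kernels of terminating games.

%-≡⇒∣ : ∀ {m} .{{_ : NonZero m}} a d → a % m ≡ (a + d) % m → m ∣ d
%-≡⇒∣ {m} a d eq = ∣m+n∣m⇒∣n {m = a / m * m} (divides ((a + d) / m)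
  (+-cancelˡ-≡ (a % m) _ _ (begin
    a % m + (a / m * m + d)              ≡⟨ +-assoc (a % m) _ d ⟨
    a % m + a / m * m + d                ≡⟨ cong (_+ d) (m≡m%n+[m/n]*n a m) ⟨
    a + d                                ≡⟨ m≡m%n+[m/n]*n (a + d) m ⟩
    (a + d) % m + (a + d) / m * m        ≡⟨ cong (_+ (a + d) / m * m) eq ⟨
    a % m + (a + d) / m * m              ∎)))
  (divides (a / m) refl)
  where open ≡-Reasoning

module Kernel {Position : Set} (_⟶_ : Position → Position → Set)
  (size : Position → ℕ) (decreasing : ∀ {x y} → x ⟶ y → size y < size x)
  (S : Position → Set)
  (stable : ∀ {x y} → S x → x ⟶ y → ¬ S y)
  (absorbing : ∀ x → S x ⊎ ∃ λ y → x ⟶ y × S y)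
  where
  open Outcome _⟶_

  disjointPN : ∀ {x} → IsP x → ¬ IsN x
  disjointPN (isP N) (isN x⟶y Py) = disjointPN Py (N x⟶y)

  -- Every move from S leaves S by stability, and absorption supplies a reply back into S at a
  -- smaller position.
  S⇒P : ∀ {x} → S x → IsP x
  S⇒P {x} = go x (<-wellFounded (size x))
    where
    go : ∀ x → Acc _<_ (size x) → S x → IsP x
    go x (acc rec) Sx = isP λ {y} x⟶y → reply x⟶y (absorbing y)
      where
      reply : ∀ {y} → x ⟶ y → S y ⊎ (∃ λ z → y ⟶ z × S z) → IsN y
      reply x⟶y (inj₁ Sy)             = contradiction Sy (stable Sx x⟶y)
      reply x⟶y (inj₂ (z , y⟶z , Sz)) =
        isN y⟶z (go z (rec (<-trans (decreasing y⟶z) (decreasing x⟶y))) Sz)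

  P⇒S : ∀ {x} → IsP x → S x
  P⇒S {x} Px with absorbing x
  ... | inj₁ Sx             = Sx
  ... | inj₂ (y , x⟶y , Sy) = contradiction (isN x⟶y (S⇒P Sy)) (disjointPN Px)

-- The candidate P-positions and their enumeration.

data Pair (k : ℕ) : ℕ × ℕ → Set where
  AB : ∀ {n} → n ≤ k → Pair k (A n , B n)
  BA : ∀ {n} → n ≤ k → Pair k (B n , A n)

A0≡0 : A 0 ≡ 0
A0≡0 = n≤0⇒n≡0 (c≤ 0)

B0≡A0 : B 0 ≡ A 0
B0≡A0 = +-identityʳ (A 0)

-- By `A≢B` the hypothesis forces n = i = 0, the only indices at which the two sequences meet.
A≡B⇒≡ : ∀ {n i} → A n ≡ B i → B n ≡ A i
A≡B⇒≡ {n} {suc i} eq = contradiction eq (A≢B z<s)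
A≡B⇒≡ {n} {zero}  eq with A-injective (trans eq B0≡A0)
... | refl = B0≡A0

Pair-swap : ∀ {k x y} → Pair k (x , y) → Pair k (y , x)
Pair-swap (AB n≤k) = BA n≤k
Pair-swap (BA n≤k) = AB n≤k

-- Used to exclude single-pile moves between pairs.
Pair-functional : ∀ {k x y y′} → Pair k (x , y) → Pair k (x , y′) → y ≡ y′
Pair-functional p q = go p q refl
  where
  -- Separate first coordinates joined by an equation spare the pattern matching from unifying `A n`
  -- with `B i`.
  go : ∀ {k x y x′ y′} → Pair k (x , y) → Pair k (x′ , y′) → x ≡ x′ → y ≡ y′
  go (AB {n} _) (AB {i} _) eq = cong B (A-injective eq)
  go (AB {n} _) (BA {i} _) eq = A≡B⇒≡ eq
  go (BA {n} _) (AB {i} _) eq = sym (A≡B⇒≡ (sym eq))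
  go (BA {n} _) (BA {i} _) eq = cong A (B-injective eq)

-- The origin, which both constructors of `Pair` produce at n = 0, is listed once.
pairs : ℕ → List (ℕ × ℕ)
pairs zero    = (0 , 0) ∷ []
pairs (suc k) = (A (suc k) , B (suc k)) ∷ (B (suc k) , A (suc k)) ∷ pairs k

length-pairs : ∀ k → length (pairs k) ≡ 2 * k + 1
length-pairs zero    = refl
length-pairs (suc k) = trans (cong (2 +_) (length-pairs k)) (step k)
  where
  step : ∀ k → 2 + (2 * k + 1) ≡ 2 * suc k + 1
  step = solve-∀

Pair-zero : Pair 0 (0 , 0)
Pair-zero = subst (Pair 0) (cong₂ _,_ A0≡0 (trans B0≡A0 A0≡0)) (AB z≤n)

Pair-weaken : ∀ {k x} → Pair k x → Pair (suc k) x
Pair-weaken (AB n≤k) = AB (m≤n⇒m≤1+n n≤k)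
Pair-weaken (BA n≤k) = BA (m≤n⇒m≤1+n n≤k)

∈-pairs⁻ : ∀ k {x} → x ∈ pairs k → Pair k x
∈-pairs⁻ zero    (here refl)         = Pair-zero
∈-pairs⁻ (suc k) (here refl)         = AB ≤-refl
∈-pairs⁻ (suc k) (there (here refl)) = BA ≤-refl
∈-pairs⁻ (suc k) (there (there x∈))  = Pair-weaken (∈-pairs⁻ k x∈)

∈-pairs⁺ : ∀ k {x} → Pair k x → x ∈ pairs k
∈-pairs⁺ zero    (AB z≤n) = here (cong₂ _,_ A0≡0 (trans B0≡A0 A0≡0))
∈-pairs⁺ zero    (BA z≤n) = here (cong₂ _,_ (trans B0≡A0 A0≡0) A0≡0)
∈-pairs⁺ (suc k) (AB n≤1+k) with m≤n⇒m<n∨m≡n n≤1+k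
... | inj₁ n<1+k = there (there (∈-pairs⁺ k (AB (≤-pred n<1+k))))
... | inj₂ refl  = here refl
∈-pairs⁺ (suc k) (BA n≤1+k) with m≤n⇒m<n∨m≡n n≤1+k
... | inj₁ n<1+k = there (there (∈-pairs⁺ k (BA (≤-pred n<1+k))))
... | inj₂ refl  = there (here refl)

pairs-unique : ∀ k → Unique (pairs k)
pairs-unique zero    = [] ∷ []
pairs-unique (suc k) =
  ((λ eq → A≢B z<s (,-injectiveˡ eq)) ∷ All.tabulate (fresh (AB-fresh ∘ ∈-pairs⁻ k))) ∷
  All.tabulate (fresh (BA-fresh ∘ ∈-pairs⁻ k)) ∷
  pairs-unique k
  where
  fresh : ∀ {x : ℕ × ℕ} {xs} → ¬ x ∈ xs → ∀ {y} → y ∈ xs → x ≢ y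
  fresh x∉xs y∈xs refl = x∉xs y∈xs
  -- One new pile size suffices for both entries: swapping the pair covers the second coordinate.
  A-new : ∀ {x y} → Pair k (x , y) → x ≢ A (suc k)
  A-new (AB n≤k) eq = 1+n≰n (subst (_≤ k) (A-injective eq) n≤k)
  A-new (BA {zero}  n≤k) eq = contradiction (A-injective (trans (sym B0≡A0) eq)) λ ()
  A-new (BA {suc n} n≤k) eq = A≢B z<s (sym eq)
  AB-fresh : ¬ Pair k (A (suc k) , B (suc k))
  AB-fresh p = A-new p refl
  BA-fresh : ¬ Pair k (B (suc k) , A (suc k))
  BA-fresh p = A-new (Pair-swap p) refl

-- Stability of the pairs under the moves of the game.

module Game (m : ℕ) .{{_ : NonZero m}} where
  open Wythoff m

  k : ℕ
  k = c m

  0<m : 0 < m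
  0<m = >-nonZero⁻¹ m

  k<m : k < m
  k<m = c< 0<m

  size : Position → ℕ
  size (x , y) = x + y

  decreasing : ∀ {x y} → x ⟶ y → size y < size x
  decreasing (first {p₂ = p₂} 0<k refl)       = +-monoˡ-< p₂ (m<m+n _ 0<k)
  decreasing (second {p₁ = p₁} 0<k refl)      = +-monoʳ-< p₁ (m<m+n _ 0<k)
  decreasing (both {q₁ = q₁} {q₂} 0<k₁ 0<k₂ _ refl refl) =
    +-mono-< (m<m+n q₁ 0<k₁) (m<m+n q₂ 0<k₂)

  n∤small : ∀ {d} → 0 < d → d < m → ¬ m ∣ d
  n∤small 0<d d<m m∣d = <⇒≱ d<m (∣⇒≤ {{>-nonZero 0<d}} m∣d)

  m∣sum : ∀ {s} → 0 < s → s < m + m → m ∣ s → s ≡ m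
  m∣sum {s} 0<s s<2m (divides zero refl)          = contradiction 0<s λ ()
  m∣sum {s} 0<s s<2m (divides (suc zero) eq)      = trans eq (+-identityʳ m)
  m∣sum {s} 0<s s<2m (divides (suc (suc q)) refl) =
    contradiction s<2m (≤⇒≯ (+-monoʳ-≤ m (m≤m+n m (q * m))))

  -- The upper bound on n enters here: n φ ≤ m = i + n means n ≤ i φ, which for n > 0 excludes i φ ≤
  -- n. For n = 0, i φ ≤ 0 would force m = 0.
  A≤B-complement : ∀ {i n} → n ≤ k → i + n ≡ m → A n ≤ B i
  A≤B-complement {i} {n} n≤k i+n≡m = ⋢⇒A≤B i⋢n
    where
    i⋢n : ¬ i ⊑ n
    i⋢n i⊑n with n ≟ 0
    ... | no n≢0 = ⊑⇒⋢+ (n≢0⇒n>0 n≢0) i⊑n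
                     (subst (n ⊑_) (trans (sym i+n≡m) (+-comm i n)) (≤c⇒⊑ n≤k))
    ... | yes refl = <⇒≱ 0<m (subst (_≤ 0) (trans (sym (+-identityʳ i)) i+n≡m) (⊑⇒≤ i⊑n))

  -- For equal orientation a decrease needs i < n, and k₂ - k₁ = n - i lies strictly between 0 and
  -- m. For opposite orientation k₂ - k₁ = i + n must be m, and then `A n ≤ B i` leaves no room for
  -- k₁.
  stable-both : ∀ {n y₁ y₂ k₁ k₂} → n ≤ k → Pair k (y₁ , y₂) → 0 < k₁ →
                k₁ % m ≡ k₂ % m → A n ≡ y₁ + k₁ → B n ≢ y₂ + k₂
  stable-both {n} {k₁ = k₁} {k₂} n≤k (AB {i} i≤k) 0<k₁ k₁≡k₂ eq₁ eq₂
    with n ≤? i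
  ... | yes n≤i = <⇒≱ (m<m+n (A i) 0<k₁) (subst (_≤ A i) eq₁ (A-mono-≤ n≤i))
  ... | no n≰i with m≤n⇒∃[o]m+o≡n (<⇒≤ (≰⇒> n≰i))
  ...   | d , refl = n∤small 0<d (≤-<-trans (≤-trans (m≤n+m d i) n≤k) k<m)
                       (%-≡⇒∣ k₁ d (trans k₁≡k₂ (cong (_% m) k₂≡)))
    where
    0<d : 0 < d
    0<d = +-cancelˡ-< i _ _ (subst (_< i + d) (sym (+-identityʳ i)) (≰⇒> n≰i))
    shuffle : ∀ a i k₁ d → a + k₁ + (i + d) ≡ a + i + (k₁ + d)
    shuffle = solve-∀
    k₂≡ : k₂ ≡ k₁ + d
    k₂≡ = +-cancelˡ-≡ (B i) _ _ (trans (sym eq₂)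
      (trans (cong (_+ (i + d)) eq₁) (shuffle (A i) i k₁ d)))
  stable-both {n} {k₁ = k₁} {k₂} n≤k (BA {i} i≤k) 0<k₁ k₁≡k₂ eq₁ eq₂ =
    <⇒≱ (m<m+n (B i) 0<k₁) (subst (_≤ B i) eq₁ (A≤B-complement n≤k i+n≡m))
    where
    shuffle : ∀ a i k₁ n → a + i + k₁ + n ≡ a + (k₁ + (i + n))
    shuffle = solve-∀
    k₂≡ : k₂ ≡ k₁ + (i + n)
    k₂≡ = +-cancelˡ-≡ (A i) _ _ (trans (sym eq₂)
      (trans (cong (_+ n) eq₁) (shuffle (A i) i k₁ n)))
    0<i+n : 0 < i + n
    0<i+n = n≢0⇒n>0 λ i+n≡0 → <⇒≢ (≤-<-trans z≤n (m<m+n (B i) 0<k₁))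
      (trans (sym A0≡0) (trans (cong A (sym (m+n≡0⇒n≡0 i i+n≡0))) eq₁))
    i+n≡m : i + n ≡ m
    i+n≡m = m∣sum 0<i+n (+-mono-< (≤-<-trans i≤k k<m) (≤-<-trans n≤k k<m))
      (%-≡⇒∣ k₁ (i + n) (trans k₁≡k₂ (cong (_% m) k₂≡)))

  stable : ∀ {x y} → Pair k x → x ⟶ y → ¬ Pair k y
  stable p (second {p₁} {q₂ = q₂} {d} 0<d refl) q =
    <⇒≢ (m<m+n q₂ 0<d) (Pair-functional q p)
  stable p (first {p₂ = p₂} {q₁} {d} 0<d refl) q =
    <⇒≢ (m<m+n q₁ 0<d) (Pair-functional (Pair-swap q) (Pair-swap p))
  stable (AB n≤k) (both 0<k₁ _    k₁≡k₂ eq₁ eq₂) q = stable-both n≤k q 0<k₁ k₁≡k₂ eq₁ eq₂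
  stable (BA n≤k) (both _    0<k₂ k₁≡k₂ eq₁ eq₂) q =
    stable-both n≤k (Pair-swap q) 0<k₂ (sym k₁≡k₂) eq₂ eq₁

  -- Absorption: moves into the pairs.

  Winning : Position → Set
  Winning x = ∃ λ y → x ⟶ y × Pair k y

  second-move : ∀ {x y y′} → y′ < y → Pair k (x , y′) → Winning (x , y)
  second-move {y′ = y′} y′<y p with m≤n⇒∃[o]m+o≡n y′<y
  ... | d , refl = _ , second z<s (sym (+-suc y′ d)) , p

  -- The equation makes d exceed y′ - x′ by t m, so the move removes x - x′ from one pile and x - x′
  -- + t m from the other.
  both-move : ∀ {x x′ y′ d} t → x′ < x → x′ + d ≡ y′ + t * m →
              Pair k (x′ , y′) → Winning (x , x + d)
  both-move {x′ = x′} {y′} {d} t x′<x eq p with m≤n⇒∃[o]m+o≡n x′<x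
  ... | e , refl = _ , both {k₁ = suc e} {k₂ = suc e + t * m} z<s z<s
      (sym ([m+kn]%n≡m%n (suc e) t m)) (sym (+-suc x′ e)) y≡ , p
    where
    open ≡-Reasoning
    out : ∀ x′ e d → suc (x′ + e) + d ≡ suc e + (x′ + d)
    out = solve-∀
    in′ : ∀ e y′ s → suc e + (y′ + s) ≡ y′ + (suc e + s)
    in′ = solve-∀
    y≡ : suc (x′ + e) + d ≡ y′ + (suc e + t * m)
    y≡ = begin
      suc (x′ + e) + d        ≡⟨ out x′ e d ⟩
      suc e + (x′ + d)        ≡⟨ cong (suc e +_) eq ⟩
      suc e + (y′ + t * m)    ≡⟨ in′ e y′ (t * m) ⟩
      y′ + (suc e + t * m)    ∎

  -- Maximality of k enters here: if j φ ≤ k + 1 failed, then (k + 1) φ ≤ k + 1 + j ≤ r + j = m.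
  complement⊑ : ∀ {j r} → k < r → r + j ≡ m → j ⊑ suc k
  complement⊑ {j} k<r r+j≡m with j ⊑? suc k
  ... | yes j⊑ = j⊑
  ... | no  j⋢ = contradiction
    (⊑-upward (≤-trans (+-monoˡ-≤ j k<r) (≤-reflexive r+j≡m)) (⋢⇒⊑+ j⋢))
    (suc-c⋢ m)

  complement≤ : ∀ {j r} → k < r → r + j ≡ m → j ≤ k
  complement≤ {j} k<r r+j≡m = ≤-pred (≤-<-trans (⊑⇒≤c (complement⊑ k<r r+j≡m)) (c< z<s))

  -- Beyond A k some pair with the right difference modulo m is reachable: with
  -- r = d % m, it is (A r , B r) if r ≤ k and (B (m ∸ r) , A (m ∸ r)) otherwise.
  winning-beyond : ∀ {x} d → A (suc k) ≤ x → Winning (x , x + d)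
  winning-beyond {x} d A≤x with d % m ≤? k
  ... | yes r≤k = both-move (d / m) (<-≤-trans (A-mono-< (s≤s r≤k)) A≤x)
    (trans (cong (A r +_) (m≡m%n+[m/n]*n d m)) (sym (+-assoc (A r) r _))) (AB r≤k)
    where r = d % m
  ... | no  r≰k with m≤n⇒∃[o]m+o≡n (<⇒≤ (m%n<n d m))
  -- In `B j + d` the summands j and r combine to one further m, hence the successor.
  ...   | j , r+j≡m = both-move (suc (d / m))
    (<-≤-trans (⊑⇒B<A z<s (complement⊑ (≰⇒> r≰k) r+j≡m)) A≤x) eq
    (BA (complement≤ (≰⇒> r≰k) r+j≡m))
    where
    open ≡-Reasoning
    r = d % m
    shuffle : ∀ a j r s → a + j + (r + s) ≡ a + (r + j + s)
    shuffle = solve-∀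
    eq : B j + d ≡ A j + suc (d / m) * m
    eq = begin
      B j + d                       ≡⟨ cong (B j +_) (m≡m%n+[m/n]*n d m) ⟩
      B j + (r + d / m * m)         ≡⟨ shuffle (A j) j r (d / m * m) ⟩
      A j + (r + j + d / m * m)     ≡⟨ cong (λ s → A j + (s + d / m * m)) r+j≡m ⟩
      A j + suc (d / m) * m         ∎

  -- Beatty's theorem locates the smaller pile x. If x = `A n` with n ≤ k, then d > n allows
  -- lowering the larger pile to `B n`, and d < n allows removing equal amounts to reach
  -- `(A d , B d)`. If x = `B n`, the larger pile is at least `A n` and can be lowered to it.
  absorbing-≤ : ∀ x d → Pair k (x , x + d) ⊎ Winning (x , x + d)
  absorbing-≤ x d with cover x
  absorbing-≤ x d | isA n refl with n ≤? k
  ... | no n≰k = inj₂ (winning-beyond d (A-mono-≤ (≰⇒> n≰k)))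
  ... | yes n≤k with <-cmp d n
  ...   | tri≈ _ refl _ = inj₁ (AB n≤k)
  ...   | tri> _ _ n<d  = inj₂ (second-move (+-monoʳ-< (A n) n<d) (AB n≤k))
  ...   | tri< d<n _ _  = inj₂ (both-move 0 (A-mono-< d<n) (sym (+-identityʳ (B d)))
                                  (AB (≤-trans (<⇒≤ d<n) n≤k)))
  absorbing-≤ x d | isB n refl with n ≤? k
  ... | no n≰k = inj₂ (winning-beyond d (≤-trans (A-mono-≤ (≰⇒> n≰k)) (m≤m+n (A n) n)))
  ... | yes n≤k with m≤n⇒m<n∨m≡n (≤-trans (m≤m+n (A n) n) (m≤m+n (B n) d))
  ...   | inj₁ A<y = inj₂ (second-move A<y (BA n≤k))
  ...   | inj₂ A≡y = inj₁ (subst (λ y → Pair k (B n , y)) A≡y (BA n≤k))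

  ⟶-swap : ∀ {x y} → x ⟶ y → swap x ⟶ swap y
  ⟶-swap (first 0<k eq)                  = second 0<k eq
  ⟶-swap (second 0<k eq)                 = first 0<k eq
  ⟶-swap (both 0<k₁ 0<k₂ k₁≡k₂ eq₁ eq₂) = both 0<k₂ 0<k₁ (sym k₁≡k₂) eq₂ eq₁

  absorbing : ∀ x → Pair k x ⊎ Winning x
  absorbing (x , y) with ≤-total x y
  ... | inj₁ x≤y with m≤n⇒∃[o]m+o≡n x≤y
  ...   | d , refl = absorbing-≤ x d
  absorbing (x , y) | inj₂ y≤x with m≤n⇒∃[o]m+o≡n y≤x
  ...   | d , refl with absorbing-≤ y d
  ...     | inj₁ p             = inj₁ (Pair-swap p)
  ...     | inj₂ (_ , move , p) = inj₂ (_ , ⟶-swap move , Pair-swap p)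

  P-count : HasCardinality IsP (2 * k + 1)
  P-count = pairs k , pairs-unique k ,
    (λ x → mk⇔ (S⇒P ∘ ∈-pairs⁻ k) (∈-pairs⁺ k ∘ P⇒S)) ,
    length-pairs k
    where open Kernel _⟶_ size decreasing (Pair k) stable absorbing

-- The floor and the count combined.

open import Data.Integer using (+_)

corollary6 : (m : ℕ) .{{_ : NonZero m}} →
    ∃ λ k → IsFloor (m /φ) (+ k) × HasCardinality (Wythoff.IsP m) (2 * k + 1)
corollary6 m = c m , GoldenRatio.floor-÷φ m 0<m (c m) k<m lower upper , P-count
  where
  open Game m
  -- Equality would force m = 0 by irrationality.
  lower : c m * (c m + m) < m * m
  lower = ≤∧≢⇒< (quadratic (c⊑ m)) λ eq → <⇒≢ 0<m (sym (φ-irrational (c m) (sym eq)))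
  upper : m * m < suc (c m) * (suc (c m) + m)
  upper = ≰⇒> (suc-c⋢ m ∘ mk⊑)
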